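{- The binary operation $(x,y)\mapsto x\bmod y$ on $\mathbb{N}$ does not belong to $\langle x+y,\ 2^x\rangle$.
   Context: $\mathbb{N}$ is the set of non-negative integers. An ($r$-ary, $r\ge 1$) operation on $\mathbb{N}$ is a function $\mathbb{N}^r\to\mathbb{N}$. Conventions: $\lfloor x/0\rfloor:=0$, and $x\bmod y:=\max(x-y\lfloor x/y\rfloor,0)$, so that $x\bmod 0=x$. A set $S$ of operations on $\mathbb{N}$ is closed under substitution if, whenever $f\in S$ is $r$-ary and $g_1,\dots,g_r\in S$ are $n$-ary, the operation $\vec x\mapsto f(g_1(\vec x),\dots,g_r(\vec x))$ is in $S$. For a set $\mathcal{B}$ of operations on $\mathbb{N}$, $\langle\mathcal{B}\rangle$ denotes the closure under substitution of $\mathcal{B}\cup C\cup P$, where $C$ is the set of all constant operations on $\mathbb{N}$ (of every arity) and $P$ is the set of all projections $(x_1,\dots,x_n)\mapsto x_i$. Here $x+y$ denotes the binary operation $(x,y)\mapsto x+y$ and $2^x$ the unary operation $x\mapsto 2^x$. -}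

module Defs where

open import Data.Fin.Base using (Fin)
open import Data.Nat.Base using (ℕ; zero; suc; _+_; _*_; _∸_; _^_; _/_; NonZero)
open import Data.Vec.Base using (Vec; []; _∷_; lookup; tabulate)
open import Level using (0ℓ)
open import Relation.Binary.PropositionalEquality.Core using (_≗_)
open import Relation.Unary using (Pred; _∈_)

Op : ℕ → Set
Op r = Vec ℕ r → ℕ

OpSet : Set₁
OpSet = (r : ℕ) → Pred (Op r) 0ℓ

op₁ : (ℕ → ℕ) → Op 1
op₁ h (x ∷ []) = h x

op₂ : (ℕ → ℕ → ℕ) → Op 2
op₂ h (x ∷ y ∷ []) = h x y

-- Operations have arity at least 1. This is required in `base` and `constant`;
-- in the other constructors it follows: Fin n is inhabited in `projection`, and
-- members of ⟨ B ⟩ already have nonzero arity in `substitution` and `ext`.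
-- `ext` is there because operations are identified when they agree pointwise.
data ⟨_⟩ (B : OpSet) : OpSet where
  base         : ∀ {n} .{{_ : NonZero n}} {f : Op n} → f ∈ B n → f ∈ ⟨ B ⟩ n
  constant     : ∀ {n} .{{_ : NonZero n}} (c : ℕ) → (λ _ → c) ∈ ⟨ B ⟩ n
  projection   : ∀ {n} (i : Fin n) → (λ xs → lookup xs i) ∈ ⟨ B ⟩ n
  substitution : ∀ {r n} {f : Op r} {g : Fin r → Op n} →
                 f ∈ ⟨ B ⟩ r → (∀ i → g i ∈ ⟨ B ⟩ n) →
                 (λ xs → f (tabulate (λ i → g i xs))) ∈ ⟨ B ⟩ n
  ext          : ∀ {n} {f g : Op n} → f ≗ g → f ∈ ⟨ B ⟩ n → g ∈ ⟨ B ⟩ n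

data Plus,Pow2 : OpSet where
  plus : op₂ _+_ ∈ Plus,Pow2 2
  pow2 : op₁ (2 ^_) ∈ Plus,Pow2 1

⌊_/_⌋ : ℕ → ℕ → ℕ
⌊ x / zero ⌋      = 0
⌊ x / y@(suc _) ⌋ = x / y

-- Truncated subtraction is max (x - y ⌊x/y⌋) 0, so x mod 0 is x.
_mod_ : ℕ → ℕ → ℕ
x mod y = x ∸ y * ⌊ x / y ⌋

{-# OPTIONS --safe #-}
-- Addition and 2^x are monotone in every argument, and substitution preserves
-- monotonicity; but 1 mod 2 = 1 > 0 = 2 mod 2.
module Submission where

open import Defs
open import Data.Nat.Base using (ℕ; _≤_; z≤n; s≤s)
open import Data.Nat.Properties using (≤-refl; +-mono-≤; ^-monoʳ-≤; module ≤-Reasoning)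
open import Data.Vec.Base using (Vec; []; _∷_)
open import Data.Vec.Relation.Binary.Pointwise.Inductive
  using (Pointwise; []; _∷_; lookup; tabulate⁺)
open import Relation.Unary using (_∈_; _∉_)

-- Monotonicity for the product order is an invariant of the closure: constants and projections have
-- it, and it survives composition. Both generators have it, whereas remainders drop to 0 at
-- multiples of the divisor.

Monotone : OpSet
Monotone n f = ∀ {xs ys : Vec ℕ n} → Pointwise _≤_ xs ys → f xs ≤ f ys

-- Induction on the derivation. For `substitution`, larger inputs make every inner value larger, so
-- the outer operation compares the two tuples of values.
⟨⟩-monotone : ∀ {B : OpSet} → (∀ {n} {f : Op n} → f ∈ B n → f ∈ Monotone n) →
              ∀ {n} {f : Op n} → f ∈ ⟨ B ⟩ n → f ∈ Monotone n
⟨⟩-monotone mono (base f∈B) = mono f∈B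
⟨⟩-monotone mono (constant c) _ = ≤-refl
⟨⟩-monotone mono (projection i) xs≤ys = lookup xs≤ys i
⟨⟩-monotone mono (substitution f∈ g∈) xs≤ys =
  ⟨⟩-monotone mono f∈ (tabulate⁺ λ i → ⟨⟩-monotone mono (g∈ i) xs≤ys)
⟨⟩-monotone mono (ext {f = f} {g} f≗g f∈) {xs} {ys} xs≤ys = begin
  g xs ≡⟨ f≗g xs ⟨
  f xs ≤⟨ ⟨⟩-monotone mono f∈ xs≤ys ⟩
  f ys ≡⟨ f≗g ys ⟩
  g ys ∎
  where open ≤-Reasoning

Plus,Pow2-monotone : ∀ {n} {f : Op n} → f ∈ Plus,Pow2 n → f ∈ Monotone n
Plus,Pow2-monotone plus (x≤x′ ∷ y≤y′ ∷ []) = +-mono-≤ x≤x′ y≤y′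
Plus,Pow2-monotone pow2 (x≤x′ ∷ []) = ^-monoʳ-≤ 2 x≤x′

theorem8 : op₂ _mod_ ∉ ⟨ Plus,Pow2 ⟩ 2
-- The inequality obtained is `1 mod 2 ≤ 2 mod 2`, which computes to the empty type `1 ≤ 0`.
theorem8 mod∈ with () ← ⟨⟩-monotone Plus,Pow2-monotone mod∈
  {1 ∷ 2 ∷ []} {2 ∷ 2 ∷ []} (s≤s z≤n ∷ ≤-refl ∷ [])
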